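{- Let $k<n$ be positive integers. The large selective height of an $l$-generated PI-algebra satisfying an admissible polynomial identity of degree $n$, over the set of non-cyclic words of length $k$, is less than $2(n-1)\,\beth(k,l,n)$.
   Context: Algebras are associative; an admissible polynomial identity of degree $n$ is one in which some monomial of highest degree $n$ has coefficient $1$. Words are over the alphabet of generators $a_1<\dots<a_l$, compared lexicographically; two words are incomparable if one is a prefix of the other, comparable otherwise. A word is non-cyclic if it is not a proper power $v^r$, $r>1$. Two words are strongly comparable if all their cyclic shifts are comparable (for words of equal length: they are not cyclic shifts of each other). A word $W$ is $n$-divisible if $W=W_0W_1\cdots W_n$ with $W_1,\dots,W_n$ in lexicographically decreasing order. Large selective height (threshold $2n$) of a word $W$ over a set $Z$ of words of one fixed length: the maximal $h$ such that $W$ contains $h$ pairwise disjoint subwords of the form $z^m$, $z\in Z$, $m>2n$, such that the periods of neighbouring subwords of this selection are not cyclic shifts of each other. For a set of words it is the supremum over its elements; for an algebra as in the claim it is that of the set of non-$n$-divisible words in the generators. Definition of $\beth(t,l,n)$ (with $t<n$): a word-cycle is a word together with all its cyclic shifts. A class $X(t,l)$ is any set of pairwise strongly comparable word-cycles of non-cyclic words of length $t$ over the alphabet $a_1<\dots<a_l$, numbered by natural numbers starting from $1$, with the following partial order on the words belonging to these word-cycles: $u\prec v$ if $u$ is lexicographically smaller than $v$ and the word-cycle containing $u$ has a smaller number than the word-cycle containing $v$. The class is $n$-good if it contains no antichain of $n$ words. Then $\beth(t,l,n)$ is the maximal possible number of elements (word-cycles) in an $n$-good class $X(t,l)$.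
   Formalization: The formal statement additionally assumes that at least one non-cyclic word of length k over the l generators exists; otherwise (e.g. l = 1, k ≥ 2) both the height and ℶ(k,l,n) are 0 and the strict inequality reads 0 < 0. -}

module Defs where

open import Level using (Level; _⊔_; suc; 0ℓ)
open import Algebra.Bundles using (CommutativeRing)
open import Algebra.Module.Bundles using (LeftModule)
open import Data.Bool.Base using (if_then_else_)
open import Data.Fin.Base as Fin using (Fin)
open import Data.List.Base as List
  using (List; []; _∷_; _++_; concat; replicate; length)
open import Data.List.NonEmpty as List⁺ using (List⁺; toList)
open import Data.List.Properties using (≡-dec)
open import Data.List.Relation.Binary.Prefix.Heterogeneous using (Prefix)
open import Data.List.Relation.Unary.All using (All)
open import Data.List.Relation.Unary.Linked using (Linked)
open import Data.Nat.Base as ℕ using (ℕ)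
open import Data.Nat.Properties using (_≟_)
open import Data.Product.Base using (Σ; ∃; ∃₂; _×_; _,_)
open import Function.Definitions using (Injective)
open import Relation.Binary.Core using (Rel)
open import Relation.Binary.PropositionalEquality using (_≡_; _≢_)
open import Relation.Nullary.Decidable.Core using (does)
open import Relation.Nullary.Negation.Core using (¬_)
open import Relation.Unary using (Pred; _∈_; _∉_)

private
  variable
    c ℓ m ℓm p : Level
    l : ℕ

IsMaximum : Pred ℕ p → Pred ℕ p
IsMaximum P h = P h × (∀ j → P j → j ℕ.≤ h)

-- sup P < N, the supremum being taken in ℕ ∪ {∞}: some upper bound of P is
-- smaller than N.  In particular the supremum is finite.
Sup_<_ : Pred ℕ p → ℕ → Set p
Sup P < N = ∃ λ u → (∀ j → P j → j ℕ.≤ u) × u ℕ.< N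

------------------------------------------------------------------------
-- Words

-- The letters a₁ < … < a_l are the elements of Fin l in their usual order.
Word : ℕ → Set
Word l = List (Fin l)

-- The library's Lex-< is not used, since it puts a proper prefix below the
-- longer word; here such words are incomparable.
infix 4 _<ˡᵉˣ_ _>ˡᵉˣ_
data _<ˡᵉˣ_ {l : ℕ} : Rel (Word l) 0ℓ where
  this : ∀ {a b u v} → a Fin.< b → (a ∷ u) <ˡᵉˣ (b ∷ v)
  next : ∀ {a u v} → u <ˡᵉˣ v → (a ∷ u) <ˡᵉˣ (a ∷ v)

_>ˡᵉˣ_ : Rel (Word l) 0ℓ
u >ˡᵉˣ v = v <ˡᵉˣ u

Comparable : Rel (Word l) 0ℓ
Comparable u v = ¬ Prefix _≡_ u v × ¬ Prefix _≡_ v u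

CyclicShift : Rel (Word l) 0ℓ
CyclicShift u v = ∃₂ λ x y → u ≡ x ++ y × v ≡ y ++ x

StronglyComparable : Rel (Word l) 0ℓ
StronglyComparable u v =
  ∀ u′ v′ → CyclicShift u u′ → CyclicShift v v′ → Comparable u′ v′

infixr 8 _^ʷ_
_^ʷ_ : Word l → ℕ → Word l
v ^ʷ r = concat (replicate r v)

NonCyclic : Pred (Word l) 0ℓ
NonCyclic u = ¬ (∃₂ λ v r → 1 ℕ.< r × u ≡ v ^ʷ r)

NonCyclicOfLength : ℕ → Pred (Word l) 0ℓ
NonCyclicOfLength k u = length u ≡ k × NonCyclic u

Divisible : ℕ → Pred (Word l) 0ℓ
Divisible n W = ∃₂ λ W₀ Ws →
  length Ws ≡ n × W ≡ W₀ ++ concat Ws × Linked _>ˡᵉˣ_ Ws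

------------------------------------------------------------------------
-- Large selective height, with threshold 2n

-- One selected subword z^m, together with the part of the word that lies
-- between it and the previously selected subword.
record Piece (l : ℕ) : Set where
  field
    gap      : Word l
    period   : Word l
    exponent : ℕ

  text : Word l
  text = gap ++ period ^ʷ exponent

open Piece

-- W contains h disjoint subwords as in the definition of the height.
Selection : ℕ → Pred (Word l) p → Word l → Pred ℕ p
Selection n Z W h = ∃₂ λ ss end →
    length ss ≡ h
  × W ≡ concat (List.map text ss) ++ end
  × All (λ s → period s ∈ Z × 2 ℕ.* n ℕ.< exponent s) ss
  × Linked (λ s s′ → ¬ CyclicShift (period s) (period s′)) ss

IsWordHeight : ℕ → Pred (Word l) p → Word l → Pred ℕ p
IsWordHeight n Z W = IsMaximum (Selection n Z W)

-- The set whose supremum is the large selective height of the set S.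
WordHeights : ℕ → Pred (Word l) p → Pred (Word l) 0ℓ → Pred ℕ p
WordHeights n Z S h = ∃ λ W → W ∈ S × IsWordHeight n Z W h

------------------------------------------------------------------------
-- The function ℶ

-- A class X(t,l) of N word-cycles.  The word-cycle with number i + 1 is
-- given by one of its words, cycle i.
record Class (t l N : ℕ) : Set where
  field
    cycle              : Fin N → Word l
    nonCyclic          : ∀ i → NonCyclicOfLength t (cycle i)
    stronglyComparable : ∀ i j → i ≢ j → StronglyComparable (cycle i) (cycle j)

  infix 4 _∈ᶜ_ _≺_
  _∈ᶜ_ : Word l → Fin N → Set
  u ∈ᶜ i = CyclicShift (cycle i) u

  _≺_ : Rel (Word l) 0ℓ
  u ≺ v = u <ˡᵉˣ v × (∃₂ λ i j → u ∈ᶜ i × v ∈ᶜ j × i Fin.< j)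

  Antichain : ℕ → Set
  Antichain n = Σ (Fin n → Word l) λ w →
      Injective _≡_ _≡_ w
    × (∀ a → ∃ λ i → w a ∈ᶜ i)
    × (∀ a b → ¬ (w a ≺ w b))

  Good : ℕ → Set
  Good n = ¬ Antichain n

-- b = ℶ(t,l,n)
Isℶ : (t l n b : ℕ) → Set
Isℶ t l n = IsMaximum (λ N → Σ (Class t l N) λ X → Class.Good X n)

------------------------------------------------------------------------
-- PI-algebras

-- Associative algebras, not necessarily with a unit.
record AssociativeAlgebra (R : CommutativeRing c ℓ) m ℓm
       : Set (c ⊔ ℓ ⊔ suc (m ⊔ ℓm)) where
  open CommutativeRing R using (ring)
  field
    leftModule : LeftModule ring m ℓm
  open LeftModule leftModule public
  infixl 7 _∙_
  field
    _∙_     : Carrierᴹ → Carrierᴹ → Carrierᴹ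
    ∙-cong  : ∀ {x x′ y y′} → x ≈ᴹ x′ → y ≈ᴹ y′ → x ∙ y ≈ᴹ x′ ∙ y′
    ∙-assoc : ∀ x y z → (x ∙ y) ∙ z ≈ᴹ x ∙ (y ∙ z)
    distribˡ : ∀ x y z → x ∙ (y +ᴹ z) ≈ᴹ (x ∙ y) +ᴹ (x ∙ z)
    distribʳ : ∀ x y z → (y +ᴹ z) ∙ x ≈ᴹ (y ∙ x) +ᴹ (z ∙ x)
    *ₗ-∙-assoc : ∀ r x y → (r *ₗ x) ∙ y ≈ᴹ r *ₗ (x ∙ y)
    *ₗ-∙-comm  : ∀ r x y → x ∙ (r *ₗ y) ≈ᴹ r *ₗ (x ∙ y)

module _ (R : CommutativeRing c ℓ) where
  open CommutativeRing R

  -- Noncommutative polynomials without constant term, as formal sums; a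
  -- monomial may occur in several summands.
  Polynomial : Set → Set c
  Polynomial X = List (Carrier × List⁺ X)

  coefficient : List⁺ ℕ → Polynomial ℕ → Carrier
  coefficient u [] = 0#
  coefficient u ((r , v) ∷ f) =
    (if does (≡-dec _≟_ (toList u) (toList v)) then r else 0#) + coefficient u f

  AdmissibleOfDegree : ℕ → Polynomial ℕ → Set ℓ
  AdmissibleOfDegree n f =
      (∃ λ u → List⁺.length u ≡ n × coefficient u f ≈ 1#)
    × (∀ v → n ℕ.< List⁺.length v → coefficient v f ≈ 0#)

  module _ (A : AssociativeAlgebra R m ℓm) where
    open AssociativeAlgebra A

    evaluate : {X : Set} → (X → Carrierᴹ) → Polynomial X → Carrierᴹ
    evaluate ρ []            = 0ᴹ
    evaluate ρ ((r , u) ∷ f) =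
      (r *ₗ List⁺.foldr₁ _∙_ (List⁺.map ρ u)) +ᴹ evaluate ρ f

  -- An l-generated algebra over R with an admissible identity of degree n.
  record PIAlgebra (l n : ℕ) m ℓm : Set (c ⊔ ℓ ⊔ suc (m ⊔ ℓm)) where
    field
      algebra : AssociativeAlgebra R m ℓm
    open AssociativeAlgebra algebra public
    field
      generator  : Fin l → Carrierᴹ
      generates  : ∀ x → ∃ λ f → x ≈ᴹ evaluate algebra generator f
      identity   : Polynomial ℕ
      admissible : AdmissibleOfDegree n identity
      satisfied  : ∀ ρ → evaluate algebra ρ identity ≈ᴹ 0ᴹ

-- By definition the large selective height of an algebra is that of the set
-- of non-n-divisible words in the generators, so it depends on the algebra
-- only through l and n.
AlgebraHeights : {R : CommutativeRing c ℓ} {n : ℕ} →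
                 PIAlgebra R l n m ℓm → Pred (Word l) p → Pred ℕ p
AlgebraHeights {n = n} A Z = WordHeights n Z (λ W → W ∉ Divisible n)

{-# OPTIONS --safe #-}

-- Let z^m be a selected power followed by a selected power of some y.  Since y
-- has the length of z and is not a rotation of z, the period z breaks off
-- before the end of the power of y, either with too small or with too great a
-- letter.  If n powers of one word-cycle break off in the same way, then words
-- z^r w, where w starts at a break and r varies monotonically, give an
-- n-division.  If |z| ≥ 2, then n - 1 such powers suffice, because the chain
-- can be preceded by a greater rotation of z.  If there are more than ℶ
-- distinct word-cycles among the periods, then some antichain of n of their
-- rotations gives an n-division.  So every power but the last one breaks off,
-- and there are at most 2(n - 2)ℶ of these if |z| ≥ 2.  For |z| = 1 a greatest
-- letter never breaks off with a greater one nor a least letter with a smaller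
-- one, and this yields (2l - 2)(n - 1) instead, where l ≤ ℶ.
module Submission where

open import Defs
open import Algebra.Bundles using (CommutativeRing)
open import Data.Nat.Base using (ℕ; _≤_; _<_; _*_; _∸_)
open import Relation.Unary using (Satisfiable)

open import Data.Fin.Base as Fin using (Fin; zero; suc)
import Data.Fin.Properties as Fin
open import Data.List.Base
  using (List; []; _∷_; _++_; concat; map; length; take; drop; lookup;
         replicate; applyUpTo; applyDownFrom)
open import Data.List.Membership.Propositional.Properties using (∈-lookup)
open import Data.List.Properties
  using (++-monoid; ++-identityʳ; ++-assoc; ∷-injective; ∷-injectiveˡ;
         ∷-injectiveʳ; length-++; length-++-≤ˡ; length-++-≤ʳ; length-map;
         length-take; length-tabulate; length-applyUpTo; length-applyDownFrom;
         take++drop≡id; concat-map-[_]; ≡-dec)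
open import Data.List.Relation.Binary.Permutation.Propositional
  using (_↭_; ↭-refl; ↭-sym; ↭-trans; prep; swap)
open import Data.List.Relation.Binary.Permutation.Propositional.Properties
  using (↭-length; All-resp-↭)
open import Data.List.Relation.Binary.Pointwise
  using (Pointwise; []; _∷_; Pointwise-≡⇒≡; Pointwise-length)
open import Data.List.Relation.Binary.Prefix.Heterogeneous using (Prefix)
import Data.List.Relation.Binary.Prefix.Heterogeneous.Properties as Prefix
open import Data.List.Relation.Binary.Sublist.Propositional
  using (_⊆_; []; _∷_; _∷ʳ_; ⊆-refl; ⊆-trans)
import Data.List.Relation.Binary.Sublist.Propositional.Properties as Sublist
open import Data.List.Relation.Unary.All as All using (All; []; _∷_)
import Data.List.Relation.Unary.All.Properties as All
open import Data.List.Relation.Unary.AllPairs using (AllPairs; []; _∷_)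
import Data.List.Relation.Unary.AllPairs.Properties as AllPairs
open import Data.List.Relation.Unary.Linked as Linked using (Linked; []; [-]; _∷_)
import Data.List.Relation.Unary.Linked.Properties as Linked
open import Data.List.Relation.Unary.Unique.Propositional.Properties using (allFin⁺)
open import Data.Nat.Base
  using (zero; suc; pred; _+_; NonZero; >-nonZero; z≤n; s≤s; z<s)
import Data.Nat.Properties as ℕ
open import Data.Nat.Solver using (module +-*-Solver)
open import Data.Product.Base using (∃; ∃₂; _×_; _,_; proj₁; proj₂)
open import Data.Sum.Base using (_⊎_; inj₁; inj₂; [_,_]′)
open import Function.Base using (_∘_)
open import Level using (0ℓ)
open import Relation.Binary.Core using (Rel)
open import Relation.Binary.Definitions using (tri<; tri≈; tri>)
open import Relation.Binary.PropositionalEquality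
  using (_≡_; _≢_; refl; sym; trans; cong; cong₂; subst; module ≡-Reasoning)
open import Relation.Nullary.Decidable using (Dec; yes; no; map′)
open import Relation.Nullary.Negation using (¬_; contradiction)
import Tactic.MonoidSolver as MonoidSolver

open Piece

private
  variable
    l : ℕ
    A : Set

-- Lists

++-levi : ∀ (a {b} c {d} : List A) → a ++ b ≡ c ++ d →
          (∃ λ e → c ≡ a ++ e × b ≡ e ++ d) ⊎ (∃ λ e → a ≡ c ++ e × d ≡ e ++ b)
++-levi []      c       eq = inj₁ (c , refl , eq)
++-levi (x ∷ a) []      eq = inj₂ (x ∷ a , refl , sym eq)
++-levi (x ∷ a) (y ∷ c) eq with ∷-injective eq
... | refl , eq′ with ++-levi a c eq′
... | inj₁ (e , p , q) = inj₁ (e , cong (x ∷_) p , q)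
... | inj₂ (e , p , q) = inj₂ (e , cong (x ∷_) p , q)

++-cancel-suffix : ∀ (a c : List A) {b d} → a ++ b ≡ c ++ d →
                   length b ≡ length d → b ≡ d
++-cancel-suffix []      []      eq _ = eq
++-cancel-suffix []      (y ∷ c) {d = d} refl len =
  contradiction (trans (sym len) (cong suc (length-++ c))) (ℕ.m≢1+n+m (length d))
++-cancel-suffix (x ∷ a) []      {b} refl len =
  contradiction (trans len (cong suc (length-++ a))) (ℕ.m≢1+n+m (length b))
++-cancel-suffix (x ∷ a) (y ∷ c) eq len =
  ++-cancel-suffix a c (∷-injectiveʳ eq) len

++-cancel-prefix : ∀ (a c : List A) {b d} → a ++ b ≡ c ++ d →
                   length a ≡ length c → a ≡ c × b ≡ d
++-cancel-prefix []      []      eq _ = refl , eq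
++-cancel-prefix (x ∷ a) (y ∷ c) eq len with ∷-injective eq
... | refl , eq′ with ++-cancel-prefix a c eq′ (ℕ.suc-injective len)
... | refl , eq″ = refl , eq″

-- Pigeonhole principles for lists

separate : ∀ {P Q : A → Set} {xs} → All (λ x → P x ⊎ Q x) xs →
  ∃₂ λ ys zs → ys ⊆ xs × zs ⊆ xs × All P ys × All Q zs ×
               length ys + length zs ≡ length xs
separate []            = [] , [] , [] , [] , [] , [] , refl
separate (inj₁ p ∷ ps) =
  let ys , zs , τ , σ , pys , qzs , len = separate ps
  in  _ ∷ ys , zs , refl ∷ τ , _ ∷ʳ σ , p ∷ pys , qzs , cong suc len
separate (inj₂ q ∷ ps) =
  let ys , zs , τ , σ , pys , qzs , len = separate ps
  in  ys , _ ∷ zs , _ ∷ʳ τ , refl ∷ σ , pys , q ∷ qzs ,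
      trans (ℕ.+-suc _ _) (cong suc len)

remaining-< : ∀ N c {y z} → suc N * c < y + z → y ≤ c → N * c < z
remaining-< N c {y} {z} lt y≤c =
  ℕ.+-cancelˡ-< c (N * c) z (ℕ.<-≤-trans lt (ℕ.+-monoˡ-≤ z y≤c))

-- At least, rather than exactly, suc c elements, to avoid cutting the lists
-- in the recursion.
pigeonhole-≥ : ∀ N {P : A → Fin N → Set} c {xs} → All (λ x → ∃ (P x)) xs →
  N * c < length xs →
  ∃₂ λ i ts → ts ⊆ xs × suc c ≤ length ts × All (λ x → P x i) ts
pigeonhole-≥ zero    c (((() , _)) ∷ _) lt
pigeonhole-≥ (suc N) {P} c {xs} ps lt
  with separate {P = λ x → P x zero} {Q = λ x → ∃ λ i → P x (suc i)} (All.map first ps)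
  where
  first : ∀ {x} → ∃ (P x) → P x zero ⊎ ∃ λ i → P x (suc i)
  first (zero  , p) = inj₁ p
  first (suc i , p) = inj₂ (i , p)
... | ys , zs , τ , σ , pys , qzs , len with suc c ℕ.≤? length ys
... | yes c<ys = zero , ys , τ , c<ys , pys
... | no  c≮ys
  with pigeonhole-≥ N c qzs
         (remaining-< N c (subst (suc N * c <_) (sym len) lt) (ℕ.≮⇒≥ c≮ys))
... | i , ts , ρ , c<ts , pts = suc i , ts , ⊆-trans ρ σ , c<ts , pts

cut : ∀ {P : A → Set} c {xs ts : List A} → ts ⊆ xs → c ≤ length ts → All P ts →
      ∃ λ us → us ⊆ xs × length us ≡ c × All P us
cut c {ts = ts} τ c≤ts ps =
  take c ts , ⊆-trans (Sublist.take-⊆ c ts) τ ,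
  trans (length-take c ts) (ℕ.m≤n⇒m⊓n≡m c≤ts) , Sublist.All-resp-⊆ (Sublist.take-⊆ c ts) ps

pigeonhole : ∀ N {P : A → Fin N → Set} c {xs} → All (λ x → ∃ (P x)) xs →
  N * c < length xs →
  ∃₂ λ i ts → ts ⊆ xs × length ts ≡ suc c × All (λ x → P x i) ts
pigeonhole N c ps lt =
  let i , ts , τ , c<ts , pts = pigeonhole-≥ N c ps lt
  in  i , cut (suc c) τ c<ts pts

-- The head is set aside and everything it is related to is discarded. As long as this removes at
-- most `c` elements at a time, `N + 1` heads can be chosen, each of them a survivor of all earlier
-- removals.
related-or-distinct : ∀ {E : Rel A 0ℓ} → (∀ x → E x x) → (∀ x y → Dec (E x y)) →
  ∀ N c (xs : List A) → N * c < length xs →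
  (∃₂ λ x ts → ts ⊆ xs × suc c ≤ length ts × All (E x) ts) ⊎
  (∃ λ ts → ts ⊆ xs × length ts ≡ suc N × AllPairs (λ x y → ¬ E x y) ts)
related-or-distinct refl-E E? zero    c (x ∷ xs) lt =
  inj₂ (x ∷ [] , refl ∷ Sublist.take-⊆ 0 xs , refl , [] ∷ [])
related-or-distinct {E = E} refl-E E? (suc N) c (x ∷ xs) lt
  with separate {P = E x} {Q = λ y → ¬ E x y} (All.universal decide xs)
  where
  decide : ∀ y → E x y ⊎ ¬ E x y
  decide y with E? x y
  ... | yes p = inj₁ p
  ... | no ¬p = inj₂ ¬p
... | ys , zs , τ , σ , pys , qzs , len with c ℕ.≤? length ys
... | yes c≤ys = inj₁ (x , x ∷ ys , refl ∷ τ , s≤s c≤ys , refl-E x ∷ pys)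
... | no  c≰ys
  with related-or-distinct refl-E E? N c zs
         (remaining-< N c (subst (suc N * c <_) (cong suc (sym len)) lt) (ℕ.≰⇒> c≰ys))
... | inj₁ (y , ts , ρ , c<ts , ets) = inj₁ (y , ts , x ∷ʳ ⊆-trans ρ σ , c<ts , ets)
... | inj₂ (ts , ρ , eq , dts) =
  inj₂ (x ∷ ts , refl ∷ ⊆-trans ρ σ , cong suc eq , Sublist.All-resp-⊆ ρ qzs ∷ dts)

-- Insertion sort

module _ {R : Rel A 0ℓ} (total : ∀ {x y} → x ≢ y → R x y ⊎ R y x) where

  -- The last component strengthens the induction: it tells the caller what may precede the new
  -- head, whether this is `x` or the old head.
  insert : ∀ x {ys} → All (x ≢_) ys → Linked R ys →
    ∃ λ zs → zs ↭ x ∷ ys × Linked R zs ×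
             (∀ w → R w x → Linked R (w ∷ ys) → Linked R (w ∷ zs))
  insert x []               _  = x ∷ [] , ↭-refl , [-] , λ w Rwx _ → Rwx ∷ [-]
  insert x {y ∷ ys} (x≢y ∷ x≢ys) lk with total x≢y
  ... | inj₁ Rxy = x ∷ y ∷ ys , ↭-refl , Rxy ∷ lk , λ w Rwx _ → Rwx ∷ Rxy ∷ lk
  ... | inj₂ Ryx with insert x x≢ys (Linked.tail lk)
  ... | zs , zs↭ , lk′ , below =
    y ∷ zs , ↭-trans (prep y zs↭) (swap y x ↭-refl) , below y Ryx lk ,
    λ { w _ (Rwy ∷ lk″) → Rwy ∷ below y Ryx lk″ }

  sort : ∀ {xs} → AllPairs _≢_ xs → ∃ λ ys → ys ↭ xs × Linked R ys
  sort []           = [] , ↭-refl , []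
  sort {x ∷ xs} (x≢xs ∷ d) =
    let ys , ys↭ , lk = sort d
        zs , zs↭ , lk′ , _ = insert x (All-resp-↭ (↭-sym ys↭) x≢xs) lk
    in  zs , ↭-trans zs↭ (prep x ys↭) , lk′

-- The lexicographic order

<-++ : ∀ {u v : Word l} a b → u <ˡᵉˣ v → u ++ a <ˡᵉˣ v ++ b
<-++ a b (this x<y) = this x<y
<-++ a b (next u<v) = next (<-++ a b u<v)

++-< : ∀ (w : Word l) {u v} → u <ˡᵉˣ v → w ++ u <ˡᵉˣ w ++ v
++-< []      u<v = u<v
++-< (x ∷ w) u<v = next (++-< w u<v)

compare : ∀ {u v : Word l} → length u ≡ length v → u ≢ v → u <ˡᵉˣ v ⊎ v <ˡᵉˣ u
compare {u = []}    {[]}    _   ne = contradiction refl ne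
compare {u = x ∷ u} {y ∷ v} len ne with Fin.<-cmp x y
... | tri< x<y _ _ = inj₁ (this x<y)
... | tri> _ _ y<x = inj₂ (this y<x)
... | tri≈ _ refl _ with compare (ℕ.suc-injective len) (ne ∘ cong (x ∷_))
... | inj₁ u<v = inj₁ (next u<v)
... | inj₂ v<u = inj₂ (next v<u)

-- Disjoint subwords in a given order

data Embeds {l} : List (Word l) → Word l → Set where
  []    : ∀ {W} → Embeds [] W
  place : ∀ g {u us W} r → W ≡ g ++ u ++ r → Embeds us r → Embeds (u ∷ us) W

embeds-++ˡ : ∀ a {us} {W : Word l} → Embeds us W → Embeds us (a ++ W)
embeds-++ˡ a []                  = []
embeds-++ˡ a (place g {u} r eq es) =
  place (a ++ g) r (trans (cong (a ++_) eq) (sym (++-assoc a g (u ++ r)))) es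

embeds-++ : ∀ {us vs} {V W : Word l} → Embeds us V → Embeds vs W →
            Embeds (us ++ vs) (V ++ W)
embeds-++ {V = V} [] fs = embeds-++ˡ V fs
embeds-++ {W = W} (place g {u} r refl es) fs =
  place g (r ++ W) (trans (++-assoc g (u ++ r) W) (cong (g ++_) (++-assoc u r W)))
        (embeds-++ es fs)

embeds-++ʳ : ∀ {us} {V : Word l} W → Embeds us V → Embeds us (V ++ W)
embeds-++ʳ W []                    = []
embeds-++ʳ W (place g {u} r refl es) =
  place g (r ++ W) (trans (++-assoc g (u ++ r) W) (cong (g ++_) (++-assoc u r W)))
        (embeds-++ʳ W es)

embeds-tail : ∀ {u us} {W : Word l} → Embeds (u ∷ us) W → Embeds us W
embeds-tail (place g {u} r refl es) = embeds-++ˡ g (embeds-++ˡ u es)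

-- A division has no gaps, so each gap is appended to the subword on its left. Only the first gap
-- remains, as `W₀`.
embeds-factors : ∀ {us} {W : Word l} → Embeds us W →
  ∃₂ λ W₀ Ws → W ≡ W₀ ++ concat Ws × Pointwise (λ u w → ∃ λ v → w ≡ u ++ v) us Ws
embeds-factors {W = W} [] = W , [] , sym (++-identityʳ W) , []
embeds-factors (place g {u} r refl es) =
  let W₀ , Ws , eq , pw = embeds-factors es
  in  g , (u ++ W₀) ∷ Ws ,
      cong (g ++_) (trans (cong (u ++_) eq) (sym (++-assoc u W₀ (concat Ws)))) ,
      (W₀ , refl) ∷ pw

decreasing-extend : ∀ {us Ws : List (Word l)} → Linked _>ˡᵉˣ_ us →
  Pointwise (λ u w → ∃ λ v → w ≡ u ++ v) us Ws → Linked _>ˡᵉˣ_ Ws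
decreasing-extend []        []         = []
decreasing-extend [-]       (_ ∷ [])   = [-]
decreasing-extend (u>v ∷ lk) ((a , refl) ∷ (b , refl) ∷ pw) =
  <-++ b a u>v ∷ decreasing-extend lk ((b , refl) ∷ pw)

-- Filling the gaps keeps the order, since a comparison by `<ˡᵉˣ` is settled at a position that both
-- words possess.
divisible : ∀ {us} {W : Word l} → Embeds us W → Linked _>ˡᵉˣ_ us →
            Divisible (length us) W
divisible es lk =
  let W₀ , Ws , eq , pw = embeds-factors es
  in  W₀ , Ws , sym (Pointwise-length pw) , eq , decreasing-extend lk pw

-- Cyclic shifts

shift-refl : ∀ (u : Word l) → CyclicShift u u
shift-refl u = [] , u , refl , sym (++-identityʳ u)

shift-sym : ∀ {u v : Word l} → CyclicShift u v → CyclicShift v u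
shift-sym (x , y , p , q) = y , x , q , p

shift-trans : ∀ {u v w : Word l} → CyclicShift u v → CyclicShift v w → CyclicShift u w
shift-trans {l} (x , y , refl , refl) (x′ , y′ , eq , refl) with ++-levi y x′ eq
... | inj₁ (e , refl , refl) = e , y′ ++ y , ++-assoc e y′ y , sym (++-assoc y′ y e)
... | inj₂ (e , refl , refl) = x ++ x′ , e , sym (++-assoc x x′ e) , ++-assoc e x x′

shift-length : ∀ {u v : Word l} → CyclicShift u v → length u ≡ length v
shift-length (x , y , refl , refl) =
  trans (length-++ x) (trans (ℕ.+-comm (length x) (length y)) (sym (length-++ y)))

take-length : ∀ (x y : List A) → take (length x) (x ++ y) ≡ x
take-length []      y = refl
take-length (c ∷ x) y = cong (c ∷_) (take-length x y)

drop-length : ∀ (x y : List A) → drop (length x) (x ++ y) ≡ y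
drop-length []      y = refl
drop-length (c ∷ x) y = drop-length x y

shift? : ∀ (u v : Word l) → Dec (CyclicShift u v)
shift? u v = map′ to from
  (Fin.any? {n = suc (length u)} λ i →
    ≡-dec Fin._≟_ v (drop (Fin.toℕ i) u ++ take (Fin.toℕ i) u))
  where
  to : (∃ λ (i : Fin (suc (length u))) →
          v ≡ drop (Fin.toℕ i) u ++ take (Fin.toℕ i) u) → CyclicShift u v
  to (i , eq) = take (Fin.toℕ i) u , drop (Fin.toℕ i) u ,
                sym (take++drop≡id (Fin.toℕ i) u) , eq
  from : CyclicShift u v → ∃ λ (i : Fin (suc (length u))) →
           v ≡ drop (Fin.toℕ i) u ++ take (Fin.toℕ i) u
  from (x , y , refl , refl) =
    Fin.fromℕ< x<u ,
    subst (λ i → y ++ x ≡ drop i u ++ take i u) (sym (Fin.toℕ-fromℕ< x<u))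
      (sym (cong₂ _++_ (drop-length x y) (take-length x y)))
    where
    x<u : length x < suc (length u)
    x<u = s≤s (length-++-≤ˡ x)

-- Powers

^ʷ-+ : ∀ (z : Word l) i j → z ^ʷ (i + j) ≡ z ^ʷ i ++ z ^ʷ j
^ʷ-+ z zero    j = refl
^ʷ-+ z (suc i) j = trans (cong (z ++_) (^ʷ-+ z i j)) (sym (++-assoc z (z ^ʷ i) (z ^ʷ j)))

^ʷ-sucʳ : ∀ (z : Word l) i → z ^ʷ suc i ≡ z ^ʷ i ++ z
^ʷ-sucʳ z i = trans (cong (z ^ʷ_) (ℕ.+-comm 1 i))
                    (trans (^ʷ-+ z i 1) (cong (z ^ʷ i ++_) (++-identityʳ z)))

^ʷ-≤ : ∀ (z : Word l) {i j} → i ≤ j → ∃ λ q → z ^ʷ j ≡ z ^ʷ q ++ z ^ʷ i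
^ʷ-≤ z {i} {j} i≤j = j ∸ i , trans (cong (z ^ʷ_) (sym (ℕ.m∸n+n≡m i≤j))) (^ʷ-+ z (j ∸ i) i)

^ʷ-< : ∀ (z : Word l) {i j} → i < j → ∃ λ q → z ^ʷ j ≡ z ^ʷ i ++ z ++ q
^ʷ-< z {i} {j} i<j =
  z ^ʷ (j ∸ suc i) ,
  trans (cong (z ^ʷ_) (trans (sym (ℕ.m+[n∸m]≡n i<j)) (sym (ℕ.+-suc i (j ∸ suc i)))))
        (^ʷ-+ z i (suc (j ∸ suc i)))

-- The passage from a period to a rotation of it costs one copy.
^ʷ-shift : ∀ (a b : Word l) i → (a ++ b) ^ʷ suc i ≡ a ++ (b ++ a) ^ʷ i ++ b
^ʷ-shift a b zero = ++-identityʳ (a ++ b)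
^ʷ-shift {l} a b (suc i) = trans (cong ((a ++ b) ++_) (^ʷ-shift a b i)) (rearrange ((b ++ a) ^ʷ i))
  where
  rearrange : ∀ c → (a ++ b) ++ a ++ c ++ b ≡ a ++ ((b ++ a) ++ c) ++ b
  rearrange c = MonoidSolver.solve (++-monoid (Fin l))

-- Deviation from periodicity

data Direction : Set where
  below above : Direction

Deviates : Direction → Rel (Word l) 0ℓ
Deviates below w z = w <ˡᵉˣ z
Deviates above w z = z <ˡᵉˣ w

match : ∀ (z R : Word l) →
  (∃ λ R′ → R ≡ z ++ R′) ⊎
  (∃ λ q → z ≡ R ++ q × length R < length z) ⊎
  (∃ λ d → Deviates d R z)
match []      R       = inj₁ (R , refl)
match (x ∷ z) []      = inj₂ (inj₁ (x ∷ z , refl , z<s))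
match (x ∷ z) (y ∷ R) with Fin.<-cmp x y
... | tri< x<y _ _ = inj₂ (inj₂ (above , this x<y))
... | tri> _ _ y<x = inj₂ (inj₂ (below , this y<x))
... | tri≈ _ refl _ with match z R
... | inj₁ (R′ , eq)             = inj₁ (R′ , cong (x ∷_) eq)
... | inj₂ (inj₁ (q , eq , len)) = inj₂ (inj₁ (q , cong (x ∷_) eq , s≤s len))
... | inj₂ (inj₂ (below , w<z))  = inj₂ (inj₂ (below , next w<z))
... | inj₂ (inj₂ (above , z<w))  = inj₂ (inj₂ (above , next z<w))

-- Copies of `z` are stripped from `R` until `match` meets the end of `R` or a wrong letter. The
-- bound `N` on the length of `R` drives the recursion.
periodic-or-deviates : ∀ N (z R : Word l) → 0 < length z → length R ≤ N →
  (∃₂ λ j p → ∃ λ q → R ≡ z ^ʷ j ++ p × z ≡ p ++ q × length p < length z) ⊎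
  (∃₂ λ d w → ∃ λ j → R ≡ z ^ʷ j ++ w × Deviates d w z)
periodic-or-deviates N z R z>0 R≤N with match z R
... | inj₂ (inj₁ (q , eq , len)) = inj₁ (0 , R , q , refl , eq , len)
... | inj₂ (inj₂ (d , dev))      = inj₂ (d , R , 0 , refl , dev)
periodic-or-deviates zero    (x ∷ z) _ z>0 () | inj₁ (R′ , refl)
periodic-or-deviates (suc N) (x ∷ z) _ z>0 (s≤s R≤N) | inj₁ (R′ , refl)
  with periodic-or-deviates N (x ∷ z) R′ z>0
         (ℕ.≤-trans (length-++-≤ʳ R′ {z}) R≤N)
... | inj₁ (j , p , q , eq , rest) =
  inj₁ (suc j , p , q ,
        trans (cong ((x ∷ z) ++_) eq) (sym (++-assoc (x ∷ z) ((x ∷ z) ^ʷ j) p)) , rest)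
... | inj₂ (d , w , j , eq , dev)  =
  inj₂ (d , w , suc j ,
        trans (cong ((x ∷ z) ++_) eq) (sym (++-assoc (x ∷ z) ((x ∷ z) ^ʷ j) w)) , dev)

-- For `j > 0` the word `z ^ʷ j ++ p` ends with `q ++ p`, a rotation of `z` with as many letters as
-- `y`. For `j = 0` it is too short to contain `y`.
periodic-suffix : ∀ (z p q Q y : Word l) j → z ≡ p ++ q → length p < length z →
  length y ≡ length z → Q ++ y ≡ z ^ʷ j ++ p → CyclicShift z y
periodic-suffix z p q Q y zero eq p<z len refl =
  contradiction (length-++-≤ʳ y {Q})
                (ℕ.<⇒≱ (subst (_ <_) (sym len) p<z))
periodic-suffix {l} z p q Q y (suc j) refl p<z len eq =
  p , q , refl ,
  ++-cancel-suffix Q (z ^ʷ j ++ p)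
    (trans eq (trans (cong (_++ p) (^ʷ-sucʳ z j)) (rearrange (z ^ʷ j))))
    (trans len (shift-length {u = z} (p , q , refl , refl)))
  where
  rearrange : ∀ c → (c ++ p ++ q) ++ p ≡ (c ++ p) ++ q ++ p
  rearrange c = MonoidSolver.solve (++-monoid (Fin l))

deviates-before : ∀ (z Q y : Word l) → 0 < length z → length y ≡ length z →
  ¬ CyclicShift z y → ∃₂ λ d w → ∃ λ j → Q ++ y ≡ z ^ʷ j ++ w × Deviates d w z
deviates-before z Q y z>0 len ¬shift
  with periodic-or-deviates (length (Q ++ y)) z (Q ++ y) z>0 ℕ.≤-refl
... | inj₁ (j , p , q , eq , z≡pq , p<z) =
  contradiction (periodic-suffix z p q Q y j z≡pq p<z len eq) ¬shift
... | inj₂ dev = dev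

-- The order on exponents that makes the words z ^ r ++ w decrease.
Before : Direction → Rel ℕ 0ℓ
Before below r r′ = r′ < r
Before above r r′ = r < r′

Deviating : Direction → Word l → ℕ → Word l → Set
Deviating d z r u = ∃ λ w → Deviates d w z × u ≡ z ^ʷ r ++ w

-- After the common part `z ^ʷ r` the right-hand word has one more copy of `z`, where the left-hand
-- one continues with the smaller `w`.
^ʷ-deviates-< : ∀ (z : Word l) {w w′ r r′} → r < r′ → w <ˡᵉˣ z →
                z ^ʷ r ++ w <ˡᵉˣ z ^ʷ r′ ++ w′
^ʷ-deviates-< z {w} {w′} {r} r<r′ w<z with ^ʷ-< z r<r′
... | q , eq rewrite eq | ++-assoc (z ^ʷ r) (z ++ q) w′ | ++-assoc z q w′
  = ++-< (z ^ʷ r) (subst (_<ˡᵉˣ _) (++-identityʳ w) (<-++ [] (q ++ w′) w<z))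

^ʷ-deviates-> : ∀ (z : Word l) {w w′ r r′} → r < r′ → z <ˡᵉˣ w →
                z ^ʷ r ++ w >ˡᵉˣ z ^ʷ r′ ++ w′
^ʷ-deviates-> z {w} {w′} {r} r<r′ z<w with ^ʷ-< z r<r′
... | q , eq rewrite eq | ++-assoc (z ^ʷ r) (z ++ q) w′ | ++-assoc z q w′
  = ++-< (z ^ʷ r) (subst (_ <ˡᵉˣ_) (++-identityʳ w) (<-++ (q ++ w′) [] z<w))

deviating-decreasing : ∀ d (z : Word l) {rs us} → Linked (Before d) rs →
  Pointwise (Deviating d z) rs us → Linked _>ˡᵉˣ_ us
deviating-decreasing d z [] [] = []
deviating-decreasing d z [-] (_ ∷ []) = [-]
deviating-decreasing below z (r′<r ∷ lk) ((w , _ , refl) ∷ (w′ , w′<z , refl) ∷ pw) =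
  ^ʷ-deviates-< z r′<r w′<z ∷ deviating-decreasing below z lk ((w′ , w′<z , refl) ∷ pw)
deviating-decreasing above z (r<r′ ∷ lk) ((w , z<w , refl) ∷ dev′ ∷ pw) with dev′
... | w′ , _ , refl =
  ^ʷ-deviates-> z r<r′ z<w ∷ deviating-decreasing above z lk (dev′ ∷ pw)

-- The range starts at 1, so that every `z ^ʷ r ++ w` begins with `z` and a rotation greater than
-- `z` can be put before the chain.
exponents : ∀ d c → ∃ λ rs → length rs ≡ c × Linked (Before d) rs ×
                             All (λ r → 1 ≤ r × r ≤ c) rs
exponents below c =
  applyDownFrom suc c , length-applyDownFrom suc c ,
  Linked.applyDownFrom⁺₂ suc c (λ i → ℕ.≤-refl) ,
  All.applyDownFrom⁺₁ suc c (λ i<c → s≤s z≤n , i<c)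
exponents above c =
  applyUpTo suc c , length-applyUpTo suc c ,
  Linked.applyUpTo⁺₂ suc c (λ i → ℕ.≤-refl) ,
  All.applyUpTo⁺₁ suc c (λ i<c → s≤s z≤n , i<c)

-- Consecutive selected powers

consecutive : List (Piece l) → List (Piece l × Piece l)
consecutive []            = []
consecutive (s ∷ [])      = []
consecutive (s ∷ s′ ∷ ss) = (s , s′) ∷ consecutive (s′ ∷ ss)

first : Piece l × Piece l → Word l
first (s , _) = period s

region : Piece l × Piece l → Word l
region (s , s′) = period s ^ʷ exponent s ++ text s′

-- The additional rotation v serves to prepend a larger word to a decreasing
-- chain of words z ^ r ++ w.
DeviatesAfter : ℕ → Direction → Word l → Piece l × Piece l → Set
DeviatesAfter n d z t = ∃ λ w → Deviates d w z ×
  (∀ r v → r ≤ n → CyclicShift (first t) v → Embeds (v ∷ (z ^ʷ r ++ w) ∷ []) (region t))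

-- With `u = a ++ b` and `z = b ++ a`, two copies of `u` hold the rotation `v`, and the others
-- become `a ++ z ^ʷ m ++ b`. The break is sought from this last `b` on, in a word that ends with
-- `y`.
deviates-after : ∀ {n M M′} (u g y : Word l) {z} → 2 ≤ n → 2 * n < M → 0 < M′ →
  CyclicShift u z → 0 < length u → length y ≡ length u → ¬ CyclicShift u y →
  ∃₂ λ d w → Deviates d w z ×
    (∀ r v → r ≤ n → CyclicShift u v →
      Embeds (v ∷ (z ^ʷ r ++ w) ∷ []) (u ^ʷ M ++ g ++ y ^ʷ M′))
deviates-after {l} {n} {M} {suc m′} u g y {z} 2≤n 2n<M _ sh@(a , b , refl , refl) u>0 len ¬shift
  with long
  where
  -- Two copies go to `v` and one is lost in the passage to `z`. As `2 ≤ n` gives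
  -- `3 + n ≤ 2 * n + 1 ≤ M`, at least `n` copies remain.
  long : ∃ λ m → M ≡ 3 + m × n ≤ m
  long = M ∸ 3 , sym (ℕ.m+[n∸m]≡n (ℕ.≤-trans (ℕ.m≤m+n 3 n) 3+n≤M)) ,
         ℕ.≤-trans (ℕ.≤-reflexive (sym (ℕ.m+n∸m≡n 3 n))) (ℕ.∸-monoˡ-≤ 3 3+n≤M)
    where
    3+n≤M : 3 + n ≤ M
    3+n≤M = ℕ.≤-trans
      (s≤s (ℕ.≤-trans (ℕ.+-monoˡ-≤ n 2≤n)
                      (ℕ.≤-reflexive (cong (n +_) (sym (ℕ.+-identityʳ n)))))) 2n<M
... | m , refl , n≤m
  with deviates-before z (b ++ g ++ y ^ʷ m′) y
         (subst (0 <_) (shift-length sh) u>0) (trans len (shift-length sh))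
         (λ sh′ → ¬shift (shift-trans sh sh′))
... | d , w , j , eq , dev = d , w , dev , embeds
  where
  T : Word l
  T = g ++ y ^ʷ suc m′
  regroup₀ : ∀ c → b ++ g ++ c ++ y ≡ (b ++ g ++ c) ++ y
  regroup₀ c = MonoidSolver.solve (++-monoid (Fin l))
  tail-eq : b ++ T ≡ z ^ʷ j ++ w
  tail-eq = trans (cong (λ c → b ++ g ++ c) (^ʷ-sucʳ y m′))
                  (trans (regroup₀ (y ^ʷ m′)) eq)
  embeds : ∀ r v → r ≤ n → CyclicShift (a ++ b) v →
           Embeds (v ∷ (z ^ʷ r ++ w) ∷ []) ((a ++ b) ^ʷ (3 + m) ++ T)
  embeds r v r≤n (x , y , xy , refl)
    -- A block of `m + j` copies of `z` stands before `w`. Its last `r` copies are kept and the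
    -- others join the gap.
    with ^ʷ-≤ z (ℕ.≤-trans r≤n (ℕ.≤-trans n≤m (ℕ.m≤m+n m j)))
  ... | q , qr =
    place x (y ++ (a ++ b) ^ʷ suc m ++ T)
      (trans (cong (λ c → (c ++ c ++ (a ++ b) ^ʷ suc m) ++ T) xy)
             (regroup₁ ((a ++ b) ^ʷ suc m) T))
      (embeds-++ˡ y
        (place (a ++ z ^ʷ q) []
          (begin
            (a ++ b) ^ʷ suc m ++ T         ≡⟨ cong (_++ T) (^ʷ-shift a b m) ⟩
            (a ++ z ^ʷ m ++ b) ++ T        ≡⟨ regroup₂ (z ^ʷ m) T ⟩
            a ++ z ^ʷ m ++ b ++ T          ≡⟨ cong (λ c → a ++ z ^ʷ m ++ c) tail-eq ⟩
            a ++ z ^ʷ m ++ z ^ʷ j ++ w     ≡⟨ cong (a ++_) (sym (++-assoc (z ^ʷ m) (z ^ʷ j) w)) ⟩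
            a ++ (z ^ʷ m ++ z ^ʷ j) ++ w   ≡⟨ cong (λ c → a ++ c ++ w) (trans (sym (^ʷ-+ z m j)) qr) ⟩
            a ++ (z ^ʷ q ++ z ^ʷ r) ++ w   ≡⟨ regroup₃ (z ^ʷ q) (z ^ʷ r) ⟩
            (a ++ z ^ʷ q) ++ (z ^ʷ r ++ w) ++ [] ∎)
          []))
    where
    open ≡-Reasoning
    regroup₁ : ∀ c t → ((x ++ y) ++ (x ++ y) ++ c) ++ t ≡ x ++ (y ++ x) ++ y ++ c ++ t
    regroup₁ c t = MonoidSolver.solve (++-monoid (Fin l))
    regroup₂ : ∀ c t → (a ++ c ++ b) ++ t ≡ a ++ c ++ b ++ t
    regroup₂ c t = MonoidSolver.solve (++-monoid (Fin l))
    regroup₃ : ∀ c d → a ++ (c ++ d) ++ w ≡ (a ++ c) ++ (d ++ w) ++ []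
    regroup₃ c d = MonoidSolver.solve (++-monoid (Fin l))

deviating-chain : ∀ {n d} {z : Word l} {rs ts} → length rs ≡ length ts →
  All (_≤ n) rs → All (DeviatesAfter n d z) ts →
  ∃ λ us → Pointwise (Deviating d z) rs us ×
    Pointwise (λ t u → ∀ v → CyclicShift (first t) v → Embeds (v ∷ u ∷ []) (region t)) ts us
deviating-chain {rs = []} _ [] [] = [] , [] , []
deviating-chain {z = z} {r ∷ rs} {t ∷ ts} len (r≤n ∷ rs≤n) ((w , dev , emb) ∷ devs) =
  let us , pw , qw = deviating-chain (ℕ.suc-injective len) rs≤n devs
  in  (z ^ʷ r ++ w) ∷ us , (w , dev , refl) ∷ pw , (λ v → emb r v r≤n) ∷ qw

Unrelated : Rel (Piece l) 0ℓ
Unrelated s s′ = ¬ CyclicShift (period s) (period s′)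

-- Regions of consecutive pairs overlap only for adjacent pairs, and adjacent
-- pairs do not start with cyclically equivalent periods.
embeds-regions : ∀ {l} {z : Word l} ss → Linked Unrelated ss → ∀ {ts uss} → ts ⊆ consecutive ss →
  All (λ t → CyclicShift (first t) z) ts →
  Pointwise (λ us t → Embeds us (region t)) uss ts →
  Embeds (concat uss) (concat (map text ss))
-- The region of `(s , s′)` has used up `text s′`, which leaves `ss`. This suffices, as the pair
-- that starts with `s′` cannot be in `ts`: its first period would be a rotation of `period s`.
embeds-after : ∀ {z : Word l} s s′ ss → Linked Unrelated (s ∷ s′ ∷ ss) → CyclicShift (period s) z →
  ∀ {ts uss} → ts ⊆ consecutive (s′ ∷ ss) →
  All (λ t → CyclicShift (first t) z) ts →
  Pointwise (λ us t → Embeds us (region t)) uss ts →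
  Embeds (concat uss) (concat (map text ss))

embeds-regions []       _ [] [] [] = []
embeds-regions (s ∷ []) _ [] [] [] = []
embeds-regions (s ∷ s′ ∷ ss) (_ ∷ lk) (_ ∷ʳ τ) shs es =
  embeds-++ˡ (text s) (embeds-regions (s′ ∷ ss) lk τ shs es)
embeds-regions {l} (s ∷ s′ ∷ ss) lk (refl ∷ τ) (sh ∷ shs) (e ∷ es) =
  subst (Embeds _) (regroup (gap s) (period s ^ʷ exponent s) (text s′) _)
    (embeds-++ˡ (gap s) (embeds-++ e (embeds-after s s′ ss lk sh τ shs es)))
  where
  regroup : ∀ (g p t c : Word l) → g ++ (p ++ t) ++ c ≡ (g ++ p) ++ t ++ c
  regroup g p t c = MonoidSolver.solve (++-monoid (Fin l))

embeds-after s s′ []        lk sh [] [] [] = []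
embeds-after s s′ (s″ ∷ ss) (_ ∷ _ ∷ lk) sh (_ ∷ʳ τ) shs es =
  embeds-regions (s″ ∷ ss) lk τ shs es
embeds-after s s′ (s″ ∷ ss) (¬sh ∷ _) sh (refl ∷ τ) (sh′ ∷ _) es =
  contradiction (shift-trans sh (shift-sym sh′)) ¬sh

embeds-singles : ∀ {ts : List (Piece l × Piece l)} {us} →
  Pointwise (λ t u → ∀ v → CyclicShift (first t) v → Embeds (v ∷ u ∷ []) (region t)) ts us →
  Pointwise (λ us t → Embeds us (region t)) (map (_∷ []) us) ts
embeds-singles []                 = []
embeds-singles {ts = t ∷ _} (e ∷ es) =
  embeds-tail (e (first t) (shift-refl (first t))) ∷ embeds-singles es

module _ {l n : ℕ} {d : Direction} {z : Word l} {ss : List (Piece l)}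
         {ts : List (Piece l × Piece l)}
         (lk : Linked Unrelated ss) (τ : ts ⊆ consecutive ss)
         (shs : All (λ t → CyclicShift (first t) z) ts)
         (devs : All (DeviatesAfter n d z) ts) where

  recurrent-divisible : length ts ≡ n → Divisible n (concat (map text ss))
  recurrent-divisible len with exponents d n
  ... | rs , len-rs , before , bounds
    with deviating-chain (trans len-rs (sym len)) (All.map proj₂ bounds) devs
  ... | us , pw , es =
    subst (λ m → Divisible m (concat (map text ss))) (trans (sym (Pointwise-length pw)) len-rs)
      (divisible (subst (λ vs → Embeds vs (concat (map text ss))) (concat-map-[_] us)
                   (embeds-regions ss lk τ shs (embeds-singles es)))
                 (deviating-decreasing d z before pw))

  -- The region of the first pair supplies two words: `M` and, after it, the head `u` of the chain,
  -- which begins with `z` and is therefore smaller than `M`.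
  recurrent-divisible-suc : ∀ {c M} → CyclicShift z M → z <ˡᵉˣ M → length ts ≡ suc c →
    suc c ≤ n → Divisible (suc (suc c)) (concat (map text ss))
  recurrent-divisible-suc {c} {M} shM z<M len c<n with exponents d (suc c)
  ... | rs , len-rs , before , bounds
    with deviating-chain (trans len-rs (sym len))
           (All.map (λ b → ℕ.≤-trans (proj₂ b) c<n) bounds) devs
  recurrent-divisible-suc {c} {M} shM z<M len c<n
      | suc r ∷ rs , len-rs , before , bounds
      | u ∷ us , pw@((w , _ , refl) ∷ _) , e ∷ es =
    subst (λ m → Divisible m (concat (map text ss)))
      (cong suc (trans (sym (Pointwise-length pw)) len-rs))
      (divisible (subst (λ vs → Embeds (M ∷ u ∷ vs) (concat (map text ss))) (concat-map-[_] us)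
                   (embeds-regions ss lk τ shs
                     (e M (shift-trans (All.head shs) shM) ∷ embeds-singles es)))
                 (M>u ∷ deviating-decreasing d z before pw))
    where
    M>u : M >ˡᵉˣ u
    M>u = subst (_ <ˡᵉˣ_) (++-identityʳ M)
            (subst (_<ˡᵉˣ M ++ []) (sym (++-assoc z (z ^ʷ r) w)) (<-++ (z ^ʷ r ++ w) [] z<M))
  recurrent-divisible-suc {c} {M} shM z<M len c<n
      | zero ∷ rs , len-rs , before , (() , _) ∷ _ | _

-- Classes of word-cycles

prefix-≡ : ∀ {u v : Word l} → length u ≡ length v → Prefix _≡_ u v → u ≡ v
prefix-≡ len p = Pointwise-≡⇒≡ (Prefix.toPointwise len p)

-- Distinct words of equal length are comparable, so strong comparability amounts to not being
-- rotations of each other.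
class : ∀ {k N} (cycle : Fin N → Word l) → (∀ i → NonCyclicOfLength k (cycle i)) →
        (∀ i j → i ≢ j → ¬ CyclicShift (cycle i) (cycle j)) → Class k l N
class cycle nonCyclic unrelated = record
  { cycle              = cycle
  ; nonCyclic          = nonCyclic
  ; stronglyComparable = λ i j i≢j u v i~u j~v →
      let distinct : ¬ u ≡ v
          distinct = λ { refl → unrelated i j i≢j (shift-trans i~u (shift-sym j~v)) }
          len : length u ≡ length v
          len = trans (sym (shift-length i~u))
                  (trans (proj₁ (nonCyclic i))
                    (trans (sym (proj₁ (nonCyclic j))) (shift-length j~v)))
      in  distinct ∘ prefix-≡ len , distinct ∘ sym ∘ prefix-≡ (sym len)
  }

lookup-unrelated : ∀ {ts : List (Piece l)} → AllPairs Unrelated ts → ∀ i j → i ≢ j →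
                   Unrelated (lookup ts i) (lookup ts j)
lookup-unrelated (_ ∷ _)  zero    zero    i≢j = contradiction refl i≢j
lookup-unrelated (d ∷ _)  zero    (suc j) _   = All.lookup d (∈-lookup j)
lookup-unrelated (d ∷ _)  (suc i) zero    _   = All.lookup d (∈-lookup i) ∘ shift-sym
lookup-unrelated (_ ∷ ds) (suc i) (suc j) i≢j = lookup-unrelated ds i j (i≢j ∘ cong suc)

-- Rotations u of the periods of selected powers, each period possibly serving
-- several u, in the order of the powers

data Assigned {l} : List (Piece l) → List (Word l) → Set where
  []   : ∀ {ts} → Assigned ts []
  skip : ∀ {t ts us} → Assigned ts us → Assigned (t ∷ ts) us
  use  : ∀ {t ts u us} → CyclicShift (period t) u → Assigned (t ∷ ts) us →
         Assigned (t ∷ ts) (u ∷ us)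

assigned-⊆ : ∀ {ts ss us} → ts ⊆ ss → Assigned {l} ts us → Assigned ss us
assigned-⊆ _          []          = []
assigned-⊆ (s ∷ʳ τ)   as@(skip _)   = skip (assigned-⊆ τ as)
assigned-⊆ (s ∷ʳ τ)   as@(use _ _)  = skip (assigned-⊆ τ as)
assigned-⊆ (refl ∷ τ) (skip as)   = skip (assigned-⊆ τ as)
assigned-⊆ (refl ∷ τ) (use sh as) = use sh (assigned-⊆ (refl ∷ τ) as)

use-lookup : ∀ ts (i : Fin (length ts)) {u us} → CyclicShift (period (lookup ts i)) u →
  Assigned (drop (Fin.toℕ i) ts) us → Assigned {l} (drop (Fin.toℕ i) ts) (u ∷ us)
use-lookup (t ∷ ts) zero    sh as = use sh as
use-lookup (t ∷ ts) (suc i) sh as = use-lookup ts i sh as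

-- The powers before the index of the current word are dropped. Since the indices do not decrease,
-- the later words find their powers among the rest.
monotone-assigned : ∀ {ts : List (Piece l)} (w : A → Word l) (i : A → Fin (length ts)) →
  (∀ a → CyclicShift (period (lookup ts (i a))) (w a)) →
  ∀ {as} → Linked (λ a b → i a Fin.≤ i b) as → Assigned ts (map w as)
monotone-assigned w i sh [] = []
monotone-assigned {ts = ts} w i sh {a ∷ as} lk =
  assigned-⊆ (Sublist.drop⁺ {m = Fin.toℕ (i a)} z≤n ⊆-refl) (from lk)
  where
  from : ∀ {a as} → Linked (λ a b → i a Fin.≤ i b) (a ∷ as) →
         Assigned (drop (Fin.toℕ (i a)) ts) (map w (a ∷ as))
  from {a} [-]         = use-lookup ts (i a) (sh a) []
  from {a} (i≤j ∷ lk) = use-lookup ts (i a) (sh a) (assigned-⊆ (Sublist.drop⁺ i≤j ⊆-refl) (from lk))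

-- Every rotation of t is a subword of t t.
embeds-assigned : ∀ {n} {ts : List (Piece l)} {us} → All (λ t → 2 * n < exponent t) ts →
  length us ≤ n → Assigned ts us → Embeds us (concat (map text ts))
-- Here `j` counts the free copies of the current period, and each word spends two of them. A fresh
-- power has more than `2 * n` copies, enough even if it has to hold all the words.
embeds-assigned-^ʷ : ∀ {n t} {ts : List (Piece l)} {us} j → All (λ t → 2 * n < exponent t) ts →
  length us ≤ n → 2 * length us ≤ j → Assigned (t ∷ ts) us →
  Embeds us (period t ^ʷ j ++ concat (map text ts))

embeds-assigned _        _    [] = []
embeds-assigned {ts = t ∷ ts} (_ ∷ ps) us≤n (skip as) =
  embeds-++ˡ (text t) (embeds-assigned ps us≤n as)
embeds-assigned {ts = t ∷ ts} (p ∷ ps) us≤n as@(use _ _) =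
  subst (Embeds _) (sym (++-assoc (gap t) (period t ^ʷ exponent t) _))
    (embeds-++ˡ (gap t)
      (embeds-assigned-^ʷ (exponent t) ps us≤n
        (ℕ.≤-trans (ℕ.*-monoʳ-≤ 2 us≤n) (ℕ.<⇒≤ p)) as))

embeds-assigned-^ʷ j ps _ _ [] = []
embeds-assigned-^ʷ {t = t} j ps us≤n _ (skip as) =
  embeds-++ˡ (period t ^ʷ j) (embeds-assigned ps us≤n as)
embeds-assigned-^ʷ {l} {t = t} {ts} {u ∷ us} j ps us<n 2us≤j (use (x , y , eq , refl) as)
  with j | ℕ.≤-trans (ℕ.≤-reflexive (sym (ℕ.*-suc 2 (length us)))) 2us≤j
... | suc (suc i) | s≤s (s≤s 2us≤i) =
  place x (y ++ period t ^ʷ i ++ concat (map text ts))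
    (trans (cong (λ z → (z ++ z ++ period t ^ʷ i) ++ concat (map text ts)) eq)
           (regroup (period t ^ʷ i) (concat (map text ts))))
    (embeds-++ˡ y (embeds-assigned-^ʷ i ps (ℕ.<⇒≤ us<n) 2us≤i as))
  where
  regroup : ∀ c d → ((x ++ y) ++ (x ++ y) ++ c) ++ d ≡ x ++ (y ++ x) ++ y ++ c ++ d
  regroup c d = MonoidSolver.solve (++-monoid (Fin l))

-- Listed in decreasing order, the words of an antichain have nondecreasing
-- numbers, so that they occur in this order in the word.
antichain-divisible : ∀ {k n} {ss ts : List (Piece l)} → ts ⊆ ss →
  All (λ s → 2 * n < exponent s) ss → (X : Class k l (length ts)) →
  (∀ i → Class.cycle X i ≡ period (lookup ts i)) →
  Class.Antichain X n → Divisible n (concat (map text ss))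
antichain-divisible {l = l} {k} {n} {ss} {ts} τ long X cycle≡ (w , w-inj , member , ¬≺)
  with sort {R = λ a b → w a >ˡᵉˣ w b} total (allFin⁺ n)
  where
  length-w : ∀ a → length (w a) ≡ k
  length-w a = trans (sym (shift-length (proj₂ (member a)))) (proj₁ (Class.nonCyclic X _))
  total : ∀ {a b} → a ≢ b → w a >ˡᵉˣ w b ⊎ w b >ˡᵉˣ w a
  total {a} {b} a≢b = compare (trans (length-w b) (sym (length-w a))) (a≢b ∘ sym ∘ w-inj)
... | as , as↭ , decreasing =
  subst (λ m → Divisible m (concat (map text ss))) len
    (divisible (embeds-assigned long (ℕ.≤-reflexive len)
                 (assigned-⊆ τ (monotone-assigned w (proj₁ ∘ member) shifts
                                 (Linked.map monotone decreasing))))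
               (Linked.map⁺ decreasing))
  where
  len : length (map w as) ≡ n
  len = trans (length-map w as) (trans (↭-length as↭) (length-tabulate {n = n} (λ i → i)))
  shifts : ∀ a → CyclicShift (period (lookup ts (proj₁ (member a)))) (w a)
  shifts a = subst (λ u → CyclicShift u (w a)) (cycle≡ _) (proj₂ (member a))
  monotone : ∀ {a b} → w a >ˡᵉˣ w b → proj₁ (member a) Fin.≤ proj₁ (member b)
  monotone {a} {b} b<a = ℕ.≮⇒≥ λ j<i →
    ¬≺ b a (b<a , _ , _ , proj₂ (member b) , proj₂ (member a) , j<i)

-- Numbered by their position, the cycles form a class too large to be good. Goodness is a negation,
-- so the antichain and the division are obtained only up to double negation.
distinct-divisible : ∀ {k n b} {ss ts : List (Piece l)} → ts ⊆ ss →
  All (λ s → NonCyclicOfLength k (period s) × 2 * n < exponent s) ss →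
  AllPairs Unrelated ts → Isℶ k l n b → b < length ts →
  ¬ ¬ Divisible n (concat (map text ss))
distinct-divisible {ts = ts} τ good unrelated (_ , maximal) b<ts ¬div =
  ℕ.<⇒≱ b<ts (maximal (length ts) (X , λ anti →
    ¬div (antichain-divisible τ (All.map proj₂ good) X (λ _ → refl) anti)))
  where
  X = class (period ∘ lookup ts)
            (λ i → All.lookup (Sublist.All-resp-⊆ τ (All.map proj₁ good)) (∈-lookup i))
            (lookup-unrelated unrelated)

-- Lower bounds for ℶ

-- The trivial rotation can be cut at either end of the word. Choosing the beginning leaves only
-- `length u` positions for the cut.
rotation-index : ∀ {u v : Word l} → 0 < length u → CyclicShift u v →
  ∃₂ λ x y → length x < length u × u ≡ x ++ y × v ≡ y ++ x
rotation-index {u = u} u>0 (x , [] , eq , refl) =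
  [] , x , u>0 , trans eq (++-identityʳ x) , sym (++-identityʳ x)
rotation-index u>0 (x , c ∷ y , refl , eq) =
  x , c ∷ y , subst (length x <_) (sym (length-++ x)) (ℕ.m<m+n (length x) z<s) , refl , eq

-- A single word-cycle has at most `k` words, too few for an antichain of `n` distinct ones.
1≤ℶ : ∀ {k n b} → 1 ≤ k → k < n → Satisfiable (NonCyclicOfLength {l} k) →
      Isℶ k l n b → 1 ≤ b
1≤ℶ {l} {k} {n} 1≤k k<n (u , refl , nc) (_ , maximal) = maximal 1 (X , good)
  where
  X : Class (length u) l 1
  X = class (λ _ → u) (λ _ → refl , nc) λ { zero zero i≢i → contradiction refl i≢i }
  good : Class.Good X n
  good (w , w-inj , member , _) =
    let a , b , a<b , eq = Fin.pigeonhole k<n (λ a → Fin.fromℕ< (proj₁ (proj₂ (proj₂ (index a)))))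
        x , y , x<u , u≡xy , wa≡yx = index a
        x′ , y′ , x′<u , u≡x′y′ , wb≡y′x′ = index b
        x≡x′ , y≡y′ = ++-cancel-prefix x x′ (trans (sym u≡xy) u≡x′y′)
          (trans (sym (Fin.toℕ-fromℕ< x<u)) (trans (cong Fin.toℕ eq) (Fin.toℕ-fromℕ< x′<u)))
    in  Fin.<⇒≢ a<b (w-inj (trans wa≡yx (trans (cong₂ _++_ y≡y′ x≡x′) (sym wb≡y′x′))))
    where
    index : ∀ a → ∃₂ λ x y → length x < length u × u ≡ x ++ y × w a ≡ y ++ x
    index a = rotation-index 1≤k (proj₂ (member a))

[]-^ʷ : ∀ r → _^ʷ_ {l} [] r ≡ []
[]-^ʷ zero    = refl
[]-^ʷ (suc r) = []-^ʷ r

letter-nonCyclic : ∀ (a : Fin l) → NonCyclicOfLength 1 (a ∷ [])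
letter-nonCyclic a = refl , λ
  { ([] , r , _ , eq) → contradiction (trans eq ([]-^ʷ r)) λ ()
  ; (c ∷ [] , suc (suc r) , _ , ())
  ; (c ∷ d ∷ v , suc r , _ , ())
  ; (c ∷ _ , suc zero , s≤s () , _) }

shift-letter : ∀ {a : Fin l} {u} → CyclicShift (a ∷ []) u → u ≡ a ∷ []
shift-letter ([]         , _  , refl , refl) = refl
shift-letter (_ ∷ []     , [] , refl , refl) = refl

letters-< : ∀ {a b : Fin l} {u v} → u ≡ a ∷ [] → v ≡ b ∷ [] → a Fin.< b → u <ˡᵉˣ v
letters-< refl refl a<b = this a<b

-- If the letters are numbered in their own order, `≺` is linear on them, so no two letters form an
-- antichain.
l≤ℶ : ∀ {n b} → 2 ≤ n → Isℶ 1 l n b → l ≤ b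
l≤ℶ {l} (s≤s (s≤s _)) (_ , maximal) = maximal l (X , good)
  where
  X : Class 1 l l
  X = class (_∷ []) letter-nonCyclic
        (λ i j i≢j sh → i≢j (sym (∷-injectiveˡ (shift-letter sh))))
  good : ∀ {n} → Class.Good X (suc (suc n))
  good (w , w-inj , member , ¬≺) with member zero | member (suc zero)
  ... | i , sh | j , sh′ with Fin.<-cmp i j
  ... | tri< i<j _ _ =
    ¬≺ zero (suc zero) (letters-< (shift-letter sh) (shift-letter sh′) i<j , i , j , sh , sh′ , i<j)
  ... | tri> _ _ j<i =
    ¬≺ (suc zero) zero (letters-< (shift-letter sh′) (shift-letter sh) j<i , j , i , sh′ , sh , j<i)
  ... | tri≈ _ refl _ with w-inj (trans (shift-letter sh) (sym (shift-letter sh′)))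
  ... | ()

-- Two rotations of a non-cyclic word

letter-^ʷ : ∀ (a : Fin l) m → (a ∷ []) ^ʷ m ≡ replicate m a
letter-^ʷ a zero    = refl
letter-^ʷ a (suc m) = cong (a ∷_) (letter-^ʷ a m)

commutes-constant : ∀ (a : A) v → v ++ a ∷ [] ≡ a ∷ v → v ≡ replicate (length v) a
commutes-constant a []      _  = refl
commutes-constant a (c ∷ v) eq with ∷-injective eq
... | refl , eq′ = cong (a ∷_) (commutes-constant a v eq′)

-- Moving the first letter to the end changes the word: otherwise all letters would be equal, and
-- the word would be a proper power of one letter.
two-rotations : ∀ (u : Word l) → 2 ≤ length u → NonCyclic u →
  ∃₂ λ z M → CyclicShift u z × CyclicShift z M × z <ˡᵉˣ M
two-rotations (a ∷ v) 2≤u nc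
  with compare (shift-length (a ∷ [] , v , refl , refl)) (λ eq →
    nc (a ∷ [] , suc (length v) , 2≤u ,
        trans (cong (a ∷_) (commutes-constant a v (sym eq))) (sym (letter-^ʷ a (suc (length v))))))
... | inj₁ u<v = a ∷ v , v ++ a ∷ [] , shift-refl (a ∷ v) , (a ∷ [] , v , refl , refl) , u<v
... | inj₂ v<u = v ++ a ∷ [] , a ∷ v , (a ∷ [] , v , refl , refl) , (v , a ∷ [] , refl , refl) , v<u

-- Divisions forced by long selections

divisible-++ʳ : ∀ {n} {V : Word l} W → Divisible n V → Divisible n (V ++ W)
divisible-++ʳ W (W₀ , Ws , len , refl , lk) =
  subst (λ m → Divisible m ((W₀ ++ concat Ws) ++ W)) len
    (divisible (embeds-++ʳ W (embeds-++ˡ W₀ (factors Ws))) lk)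
  where
  factors : ∀ Ws → Embeds Ws (concat Ws)
  factors []       = []
  factors (V ∷ Ws) = place [] (concat Ws) refl (factors Ws)

length-consecutive : ∀ (ss : List (Piece l)) → length ss ≤ suc (length (consecutive ss))
length-consecutive []            = z≤n
length-consecutive (s ∷ [])      = s≤s z≤n
length-consecutive (s ∷ s′ ∷ ss) = s≤s (length-consecutive (s′ ∷ ss))

consecutive-⊆ : ∀ (ss : List (Piece l)) → map proj₁ (consecutive ss) ⊆ ss
consecutive-⊆ []            = []
consecutive-⊆ (s ∷ [])      = s ∷ʳ []
consecutive-⊆ (s ∷ s′ ∷ ss) = refl ∷ consecutive-⊆ (s′ ∷ ss)

consecutive-all : ∀ {P : Piece l → Set} {R : Rel (Piece l) 0ℓ} {ss} → All P ss → Linked R ss →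
  All (λ t → P (proj₁ t) × P (proj₂ t) × R (proj₁ t) (proj₂ t)) (consecutive ss)
consecutive-all []           []       = []
consecutive-all (_ ∷ [])     [-]      = []
consecutive-all (p ∷ q ∷ ps) (r ∷ rs) = (p , q , r) ∷ consecutive-all (q ∷ ps) rs

Selected : ℕ → ℕ → Piece l → Set
Selected k n s = NonCyclicOfLength k (period s) × 2 * n < exponent s

SelectedPair : ℕ → ℕ → Piece l × Piece l → Set
SelectedPair k n (s , s′) = Selected k n s × Selected k n s′ × Unrelated s s′

selected-deviates : ∀ {k n} {t : Piece l × Piece l} {z} → 1 ≤ k → 2 ≤ n →
  SelectedPair k n t →
  CyclicShift (first t) z → ∃ λ d → DeviatesAfter n d z t
selected-deviates {t = s , s′} 1≤k 2≤n (((len , _) , long) , ((len′ , _) , long′) , ¬sh) sh =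
  deviates-after (period s) (gap s′) (period s′) 2≤n long (ℕ.m<n⇒0<n long′) sh
    (subst (0 <_) (sym len) 1≤k) (trans len′ (sym len)) ¬sh

-- The greatest letter cannot deviate above and the smallest
-- one cannot deviate below, which leaves 2(l - 1) possibilities.
letterDirection : ∀ l → Fin (l + l) → Fin (suc l) × Direction
letterDirection l i = [ (λ j → Fin.inject₁ j , above) , (λ j → suc j , below) ]′ (Fin.splitAt l i)

letterDirection-surjective : ∀ {l} (a : Fin (suc l)) d {w} → Deviates d w (a ∷ []) →
  ∃ λ i → letterDirection l i ≡ (a , d)
letterDirection-surjective {l} a above (this {b = b} a<b) =
  j Fin.↑ˡ l , trans (cong [ _ , _ ]′ (Fin.splitAt-↑ˡ l j l)) (cong (_, above) j≡a)
  where
  a<l = ℕ.<-≤-trans a<b (ℕ.<⇒≤pred (Fin.toℕ<n b))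
  j = Fin.fromℕ< a<l
  j≡a : Fin.inject₁ j ≡ a
  j≡a = Fin.toℕ-injective (trans (Fin.toℕ-inject₁ j) (Fin.toℕ-fromℕ< a<l))
letterDirection-surjective {l} (suc j) below (this _) =
  l Fin.↑ʳ j , cong [ _ , _ ]′ (Fin.splitAt-↑ʳ l l j)

length-1 : ∀ (u : List A) → length u ≡ 1 → ∃ λ a → u ≡ a ∷ []
length-1 (a ∷ []) _ = a , refl

LetterDeviates : ℕ → Piece (suc l) × Piece (suc l) → Fin (suc l) × Direction → Set
LetterDeviates n t (a , d) = CyclicShift (first t) (a ∷ []) × DeviatesAfter n d (a ∷ []) t

letter-deviates : ∀ {n} {t : Piece (suc l) × Piece (suc l)} → 2 ≤ n → SelectedPair 1 n t →
  ∃ λ i → LetterDeviates n t (letterDirection l i)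
letter-deviates {n = n} {t} 2≤n sel with length-1 (first t) (proj₁ (proj₁ (proj₁ sel)))
... | a , eq with subst (CyclicShift (first t)) eq (shift-refl (first t))
... | sh with selected-deviates {t = t} (s≤s z≤n) 2≤n sel sh
... | d , dev with letterDirection-surjective a d (proj₁ (proj₂ dev))
... | i , eq′ = i , subst (LetterDeviates n t) (sym eq′) (sh , dev)

letters-divisible : ∀ {ν b} (ss : List (Piece l)) → Satisfiable (NonCyclicOfLength {l} 1) →
  All (Selected 1 (2 + ν)) ss → Linked Unrelated ss → Isℶ 1 l (2 + ν) b →
  2 * suc ν * b ≤ length ss → Divisible (2 + ν) (concat (map text ss))
letters-divisible {zero} ss (() ∷ _ , _)
letters-divisible {suc l} {ν} {b} ss _ good lk isℶ many
  with pigeonhole (l + l) (suc ν)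
         (All.map (λ {t} → letter-deviates {t = t} (s≤s (s≤s z≤n))) (consecutive-all good lk)) lt
  where
  -- The two units on the left below pay for the strict inequality and for the last power, which
  -- starts no pair.
  lt : (l + l) * suc ν < length (consecutive ss)
  lt = ℕ.≤-pred (begin
    2 + (l + l) * suc ν        ≤⟨ ℕ.+-monoˡ-≤ _ (ℕ.m≤m+n 2 (2 * ν)) ⟩
    2 + 2 * ν + (l + l) * suc ν ≡⟨ identity l ν ⟩
    2 * suc ν * suc l          ≤⟨ ℕ.*-monoʳ-≤ (2 * suc ν) (l≤ℶ (s≤s (s≤s z≤n)) isℶ) ⟩
    2 * suc ν * b              ≤⟨ many ⟩
    length ss                  ≤⟨ length-consecutive ss ⟩
    suc (length (consecutive ss)) ∎)
    where
    open ℕ.≤-Reasoning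
    open +-*-Solver
    identity : ∀ l ν → 2 + 2 * ν + (l + l) * suc ν ≡ 2 * suc ν * suc l
    identity = solve 2 (λ l ν → con 2 :+ con 2 :* ν :+ (l :+ l) :* (con 1 :+ ν) :=
                                con 2 :* (con 1 :+ ν) :* (con 1 :+ l)) refl
... | i , ts , τ , len , ps =
  recurrent-divisible lk τ (All.map proj₁ ps) (All.map proj₂ ps) len

direction : Fin 2 → Direction
direction zero    = below
direction (suc _) = above

direction-surjective : ∀ d → ∃ λ i → direction i ≡ d
direction-surjective below = zero , refl
direction-surjective above = suc zero , refl

-- Either more than `b` cycles occur, or `2 * ν + 1` pairs share a cycle. Of these, `ν + 1` break
-- off in the same direction, and a greater rotation supplies the missing word.
words-divisible : ∀ {k ν b} (ss : List (Piece l)) → 2 ≤ k → 1 ≤ b →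
  All (Selected k (2 + ν)) ss → Linked Unrelated ss → Isℶ k l (2 + ν) b →
  2 * suc ν * b ≤ length ss → ¬ ¬ Divisible (2 + ν) (concat (map text ss))
words-divisible {k = k} {ν} {b} ss 2≤k 1≤b good lk isℶ many
  with related-or-distinct {E = λ t t′ → CyclicShift (first t) (first t′)}
         (λ t → shift-refl (first t)) (λ t t′ → shift? (first t) (first t′))
         b (2 * ν) (consecutive ss) lt
  where
  -- Now `1 ≤ b` pays for the same two units.
  lt : b * (2 * ν) < length (consecutive ss)
  lt = ℕ.≤-pred (begin
    2 + b * (2 * ν)            ≤⟨ ℕ.+-monoˡ-≤ _ (ℕ.*-monoʳ-≤ 2 1≤b) ⟩
    2 * b + b * (2 * ν)        ≡⟨ identity b ν ⟩
    2 * suc ν * b              ≤⟨ many ⟩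
    length ss                  ≤⟨ length-consecutive ss ⟩
    suc (length (consecutive ss)) ∎)
    where
    open ℕ.≤-Reasoning
    open +-*-Solver
    identity : ∀ b ν → 2 * b + b * (2 * ν) ≡ 2 * suc ν * b
    identity = solve 2 (λ b ν → con 2 :* b :+ b :* (con 2 :* ν) :=
                                con 2 :* (con 1 :+ ν) :* b) refl
... | inj₂ (ts , τ , len , distinct) =
  distinct-divisible (⊆-trans (Sublist.map⁺ proj₁ τ) (consecutive-⊆ ss)) good
    (AllPairs.map⁺ distinct) isℶ
    (ℕ.≤-reflexive (sym (trans (length-map proj₁ ts) len)))
... | inj₁ (x , t ∷ ts , τ , len , x~t ∷ x~ts)
  with Sublist.All-resp-⊆ τ (consecutive-all good lk)
... | sels@((((len-t , nc) , _) , _) ∷ _)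
  with two-rotations (first t) (subst (2 ≤_) (sym len-t) 2≤k) nc
... | z , M , t~z , z~M , z<M
  with All.map (λ x~t′ → shift-trans (shift-sym x~t′) (shift-trans x~t t~z)) (x~t ∷ x~ts)
... | shs
  with pigeonhole 2 ν (All.zipWith (λ {t} → deviation {t}) (sels , shs)) len
  where
  deviation : ∀ {t} → SelectedPair k (2 + ν) t × CyclicShift (first t) z →
              ∃ λ i → DeviatesAfter (2 + ν) (direction i) z t
  deviation {t} (sel , sh)
    with selected-deviates {t = t} (ℕ.<⇒≤ 2≤k) (s≤s (s≤s z≤n)) sel sh
  ... | d , dev with direction-surjective d
  ... | i , refl = i , dev
... | i , us , σ , len-us , devs = λ ¬div →
  ¬div (recurrent-divisible-suc lk (⊆-trans σ τ) (Sublist.All-resp-⊆ σ shs) devs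
         z~M z<M len-us (ℕ.n≤1+n _))

mainTheorem7 : ∀ {c ℓ m ℓm} (R : CommutativeRing c ℓ) (k n l : ℕ) → 1 ≤ k → k < n →
    Satisfiable (NonCyclicOfLength {l} k) →
    (A : PIAlgebra R l n m ℓm) →
    (b : ℕ) → Isℶ k l n b →
    Sup AlgebraHeights A (NonCyclicOfLength k) < (2 * (n ∸ 1) * b)
mainTheorem7 R (suc κ) (suc (suc ν)) l 1≤k k<n@(s≤s (s≤s _)) sat A b isℶ =
  -- The bound of the heights must lie strictly below the product, which is positive because
  -- `1 ≤ b`.
  pred (2 * suc ν * b) , bounded , ℕ.≤-reflexive (ℕ.suc-pred (2 * suc ν * b))
  where
  1≤b : 1 ≤ b
  1≤b = 1≤ℶ 1≤k k<n sat isℶ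
  instance
    nonZero : NonZero (2 * suc ν * b)
    nonZero = >-nonZero (ℕ.*-mono-≤ {1} {2 * suc ν} {1} (s≤s z≤n) 1≤b)
  dense : ∀ κ → Satisfiable (NonCyclicOfLength {l} (suc κ)) → Isℶ (suc κ) l (2 + ν) b →
    ∀ ss → All (Selected (suc κ) (2 + ν)) ss →
    Linked Unrelated ss → 2 * suc ν * b ≤ length ss → ¬ ¬ Divisible (2 + ν) (concat (map text ss))
  dense zero    sat isℶ ss good lk many ¬div = ¬div (letters-divisible ss sat good lk isℶ many)
  dense (suc κ) sat isℶ ss good lk many =
    words-divisible ss (s≤s (s≤s z≤n)) 1≤b good lk isℶ many
  bounded : ∀ h → AlgebraHeights A (NonCyclicOfLength (suc κ)) h → h ≤ pred (2 * suc ν * b)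
  -- A greater `h` only has to be led to an absurdity, for which a doubly negated division suffices.
  bounded h (W , W∉ , (ss , end , refl , refl , good , lk) , _) = ℕ.≮⇒≥ λ lt →
    dense κ sat isℶ ss good lk (subst (_≤ length ss) (ℕ.suc-pred (2 * suc ν * b)) lt)
      (W∉ ∘ divisible-++ʳ end)
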